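{- Let $W=(P,T,F)$ be a safe and sound Workflow net. Then the language of $W$, i.e. the set of all runs of $W$ regarded as a set of finite words over the alphabet $T$ of transitions, is a star-free regular language.
   Context: A Petri net is a bipartite graph $(P,T,F)$ with finite disjoint sets $P$ (places) and $T$ (transitions) and flow relation $F\subseteq (P\times T)\cup(T\times P)$. For a place $p$, its preset is ${}^{\rightarrow}p=\{t\in T: (t,p)\in F\}$ and its postset is $p^{\rightarrow}=\{t\in T:(p,t)\in F\}$. A Workflow net is a Petri net in which (1) there is a unique place $i$ (the initial place) with empty preset; (2) there is a unique place $o$ (the output place) with empty postset; (3) every place and every transition lies on a directed path of the graph from $i$ to $o$. A marking is a function $M:P\to\mathbb{Z}_{\ge 0}$. The initial marking $M_0$ maps $i$ to $1$ and every other place to $0$. A marking $M$ is final if $M(o)>0$. A marking $M$ enables $t\in T$ iff $M(p)>0$ for all places $p$ with $t\in p^{\rightarrow}$. If $t$ is enabled at $M$, it may fire, giving the marking $M'$ with $M'(p)=M(p)-[t\in p^{\rightarrow}]+[t\in{}^{\rightarrow}p]$ for every $p$, where $[\cdot]$ is $1$ if the condition holds and $0$ otherwise. A firing sequence is a finite (possibly empty) sequence $\langle t_1,\dots,t_n\rangle$ of transitions that can be fired consecutively, one at a time, starting from $M_0$. A marking is reachable if some firing sequence leads from $M_0$ to it. A run is a firing sequence leading from $M_0$ to a final marking. $W$ is safe if $M(p)\le 1$ for every reachable marking $M$ and every place $p$. $W$ is sound if: (option to complete) from every reachable marking, the marking $M_f$ with $M_f(o)=1$ and $M_f(p)=0$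 for $p\ne o$ can be reached by firing transitions; (proper completion) every reachable marking $M$ with $M(o)>0$ equals $M_f$; (no dead transitions) every $t\in T$ is enabled by some reachable marking. The star-free languages over a finite alphabet $T$ are the members of the smallest class of subsets of $T^*$ containing $\emptyset$, $\{\varepsilon\}$ and $\{t\}$ for each $t\in T$, and closed under finite union, concatenation, and complement relative to $T^*$. -}

module Defs where

open import Data.Bool.Base using (if_then_else_)
open import Data.Fin.Base using (Fin)
open import Data.Fin.Properties using (_≟_)
open import Data.List.Base using (List; []; _∷_; _++_; [_])
open import Data.Nat.Base using (ℕ; _+_; _∸_; _≤_; _>_)
open import Data.Product.Base using (_×_; _,_; ∃; ∃₂)
open import Data.Sum.Base using (_⊎_; inj₁; inj₂)
open import Level using (0ℓ)
open import Relation.Binary.Construct.Closure.ReflexiveTransitive using (Star)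
open import Relation.Binary.PropositionalEquality using (_≡_; _≗_)
open import Relation.Nullary.Decidable using (Dec; ⌊_⌋)
open import Relation.Unary using (Pred; Decidable; Empty; ∅; ｛_｝; _∪_; ∁; _≐_)

𝟙 : ∀ {a} {A : Set a} → Dec A → ℕ
𝟙 d = if ⌊ d ⌋ then 1 else 0

-- Decidability of the flow relation is what makes it a subset of a finite
-- set in the classical sense; the firing rule needs its indicator function.

record PetriNet : Set₁ where
  field
    #places #transitions : ℕ

  P : Set
  P = Fin #places

  T : Set
  T = Fin #transitions

  field
    F  : Pred (P × T ⊎ T × P) 0ℓ
    F? : Decidable F

  preset postset : P → Pred T 0ℓ
  preset  p t = F (inj₂ (t , p))
  postset p t = F (inj₁ (p , t))

  preset? : ∀ p → Decidable (preset p)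
  preset? p t = F? (inj₂ (t , p))

  postset? : ∀ p → Decidable (postset p)
  postset? p t = F? (inj₁ (p , t))

  data _⟶_ : P ⊎ T → P ⊎ T → Set where
    place→transition : ∀ {p t} → F (inj₁ (p , t)) → inj₁ p ⟶ inj₂ t
    transition→place : ∀ {t p} → F (inj₂ (t , p)) → inj₂ t ⟶ inj₁ p

  Marking : Set
  Marking = P → ℕ

  Enabled : Marking → T → Set
  Enabled M t = ∀ p → postset p t → M p > 0

  -- When t is enabled the truncated subtraction never truncates.

  Fires : Marking → T → Marking → Set
  Fires M t M′ =
    Enabled M t ×
    (∀ p → M′ p ≡ (M p ∸ 𝟙 (postset? p t)) + 𝟙 (preset? p t))

  -- Markings are functions, so they are compared pointwise throughout.

  data _[_⟩_ : Marking → List T → Marking → Set where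
    stop : ∀ {M M′} → M ≗ M′ → M [ [] ⟩ M′
    step : ∀ {M M′ M″ t ts} → Fires M t M′ → M′ [ ts ⟩ M″ → M [ t ∷ ts ⟩ M″

  singleToken : P → Marking
  singleToken q p = 𝟙 (p ≟ q)

record WorkflowNet : Set₁ where
  field
    net : PetriNet

  open PetriNet net public

  field
    i        : P
    i-source : Empty (preset i)
    i-unique : ∀ p → Empty (preset p) → p ≡ i

    o        : P
    o-sink   : Empty (postset o)
    o-unique : ∀ p → Empty (postset p) → p ≡ o

    onPath : ∀ x → Star _⟶_ (inj₁ i) x × Star _⟶_ x (inj₁ o)

  M₀ M-final : Marking
  M₀      = singleToken i
  M-final = singleToken o

  Final : Pred Marking 0ℓ
  Final M = M o > 0

  Reachable : Pred Marking 0ℓ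
  Reachable M = ∃ λ ts → M₀ [ ts ⟩ M

  Run : Pred (List T) 0ℓ
  Run ts = ∃ λ M → M₀ [ ts ⟩ M × Final M

  Safe : Set
  Safe = ∀ M → Reachable M → ∀ p → M p ≤ 1

  record Sound : Set where
    field
      optionToComplete : ∀ M → Reachable M → ∃ λ ts → M [ ts ⟩ M-final
      properCompletion : ∀ M → Reachable M → Final M → M ≗ M-final
      noDeadTransition : ∀ t → ∃ λ M → Reachable M × Enabled M t

Language : Set → Set₁
Language A = Pred (List A) 0ℓ

_·_ : ∀ {A} → Language A → Language A → Language A
(K · L) w = ∃₂ λ u v → w ≡ u ++ v × K u × L v

-- The constructor `resp` makes this a class of subsets rather than of
-- predicates.  Over a finite alphabet every member has decidable membership,
-- so the constructive complement ∁ is the usual one.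

data StarFree {A : Set} : Language A → Set₁ where
  empty      : StarFree ∅
  epsilon    : StarFree ｛ [] ｝
  letter     : ∀ a → StarFree ｛ [ a ] ｝
  union      : ∀ {K L} → StarFree K → StarFree L → StarFree (K ∪ L)
  concat     : ∀ {K L} → StarFree K → StarFree L → StarFree (K · L)
  complement : ∀ {L} → StarFree L → StarFree (∁ L)
  resp       : ∀ {K L} → K ≐ L → StarFree K → StarFree L

{-# OPTIONS --safe #-}

-- In a safe net, a place p carries a token after a firing sequence exactly when
-- the last transition that either puts a token on p or takes one away without
-- returning it is of the first kind, or when p was marked initially and there is
-- no such transition.  This is a star-free condition on the sequence.  A word is
-- a firing sequence unless it has a prefix u t such that some input place of t
-- is not marked after u, again a star-free condition.

module Submission where

open import Defs
open import Data.Empty using (⊥)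
open import Data.Fin.Base using (Fin; zero; suc)
open import Data.List.Base using ([]; _∷_; [_])
open import Data.List.Relation.Unary.All using (All; []; _∷_; all?)
open import Data.List.Relation.Unary.All.Properties using (¬Any⇒All¬; All¬⇒¬Any)
open import Data.List.Relation.Unary.Any using (Any; here; there)
open import Data.Nat.Base using (zero; suc; _+_; _∸_; _≤_; _>_; z≤n; s≤s)
open import Data.Nat.Properties using (_>?_; m≤n+m; m≤n⇒m≤n+o)
open import Data.Product.Base using (_×_; _,_; ∃; ∃₂; proj₁; proj₂)
open import Data.Sum.Base using (_⊎_; inj₁; inj₂; [_,_]′)
open import Function.Base using (_∘_)
open import Level using (0ℓ)
open import Relation.Binary.PropositionalEquality using (refl; sym; subst)
open import Relation.Nullary.Decidable
  using (Dec; yes; no; ¬?; _×-dec_; _⊎-dec_; decidable-stable)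
open import Relation.Nullary.Negation using (¬_; contradiction)
open import Relation.Unary using (Pred; Decidable; U; ∁; ｛_｝)

-- Closure properties of star-free languages.

module _ {A : Set} where

  -- Recursion on the word, rather than a concatenation, makes decidability and the removal of a
  -- first letter immediate.
  Somewhere : Pred A 0ℓ → Language A → Language A
  Somewhere S K []      = ⊥
  Somewhere S K (a ∷ w) = (S a × K w) ⊎ Somewhere S K w

  somewhere? : ∀ {S K} → Decidable S → Decidable K → Decidable (Somewhere S K)
  somewhere? S? K? []      = no λ ()
  somewhere? S? K? (a ∷ w) = (S? a ×-dec K? w) ⊎-dec somewhere? S? K? w

  starFree-U : StarFree {A} U
  starFree-U = resp ((λ _ → _) , λ _ ()) (complement empty)

  starFree-∃ : ∀ {n} {L : Fin n → Language A} →
    (∀ k → StarFree (L k)) → StarFree (λ w → ∃ λ k → L k w)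
  starFree-∃ {zero}  sf = resp ((λ ()) , λ ()) empty
  starFree-∃ {suc n} sf =
    resp ( [ (zero ,_) , (λ (k , l) → suc k , l) ]′
         , λ { (zero , l) → inj₁ l ; (suc k , l) → inj₂ (k , l) })
         (union (sf zero) (starFree-∃ (sf ∘ suc)))

  -- A condition independent of the word is decided once and for all, leaving either `L` or the
  -- empty language.
  starFree-× : ∀ {Q : Set} {L : Language A} →
    Dec Q → StarFree L → StarFree (λ w → Q × L w)
  starFree-× (yes q) sf = resp ((q ,_) , proj₂) sf
  starFree-× (no ¬q) sf = resp ((λ ()) , λ (q , _) → ¬q q) empty

module _ {n} {S : Pred (Fin n) 0ℓ} (S? : Decidable S) where

  starFree-somewhere : ∀ {K} → StarFree K → StarFree (Somewhere S K)
  starFree-somewhere {K} sf =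
    resp (to , from _)
         -- The alphabet is finite, so the letters satisfying `S` form a finite union of one-letter
         -- languages.
         (concat starFree-U
           (concat (starFree-∃ λ a → starFree-× (S? a) (letter a)) sf))
    where
    to : ∀ {w} →
      (U · ((λ x → ∃ λ a → S a × ｛ [ a ] ｝ x) · K)) w → Somewhere S K w
    to ([]    , _ , refl , _ , _ , _ , refl , (_ , s , refl) , k) = inj₁ (s , k)
    to (_ ∷ u , v , refl , _ , r) = inj₂ (to (u , v , refl , _ , r))

    from : ∀ w → Somewhere S K w →
      (U · ((λ x → ∃ λ a → S a × ｛ [ a ] ｝ x) · K)) w
    from (a ∷ w) (inj₁ (s , k)) =
      [] , _ , refl , _ , [ a ] , w , refl , (a , s , refl) , k
    from (a ∷ w) (inj₂ h) with from w h
    ... | u , v , refl , r = a ∷ u , v , refl , r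

  starFree-all-∁ : StarFree (All (∁ S))
  starFree-all-∁ =
    resp ( (λ ¬s → ¬Any⇒All¬ _ (¬s ∘ from))
         , λ all → All¬⇒¬Any all ∘ to _)
         (complement (starFree-somewhere starFree-U))
    where
    to : ∀ w → Somewhere S U w → Any S w
    to (_ ∷ _) (inj₁ (s , _)) = here s
    to (_ ∷ w) (inj₂ h)       = there (to w h)

    from : ∀ {w} → Any S w → Somewhere S U w
    from (here s)  = inj₁ (s , _)
    from (there h) = inj₂ (from h)

-- Tokens on a place and blocked words.

module _ (N : PetriNet) where
  open PetriNet N

  -- A self-loop takes a token and returns it, so it leaves `p` marked and must not count as
  -- draining.
  Drains : P → Pred T 0ℓ
  Drains p t = postset p t × ¬ preset p t

  drains? : ∀ p → Decidable (Drains p)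
  drains? p t = postset? p t ×-dec ¬? (preset? p t)

  -- The producer in the second case may be followed by others: they leave the place marked.
  MarkedAfter : Marking → P → Language T
  MarkedAfter M p w =
    (M p > 0 × All (∁ (Drains p)) w) ⊎
    Somewhere (preset p) (All (∁ (Drains p))) w

  markedAfter? : ∀ M p → Decidable (MarkedAfter M p)
  markedAfter? M p w =
    (M p >? 0 ×-dec undrained? w) ⊎-dec somewhere? (preset? p) undrained? w
    where
    undrained? : Decidable (All (∁ (Drains p)))
    undrained? = all? (¬? ∘ drains? p)

  starFree-markedAfter : ∀ M p → StarFree (MarkedAfter M p)
  starFree-markedAfter M p =
    union (starFree-× (M p >? 0) undrained)
          (starFree-somewhere (preset? p) undrained)
    where
    undrained : StarFree (All (∁ (Drains p)))
    undrained = starFree-all-∁ (drains? p)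

  -- `MarkedAfter` describes an actual marking only when the prefix before `t` is a firing sequence.
  -- This suffices: in a word that is not one, the first transition unable to fire is preceded by
  -- such a prefix.
  Blocked : Marking → Language T
  Blocked M w = ∃₂ λ t p →
    postset p t × (∁ (MarkedAfter M p) · (｛ [ t ] ｝ · U)) w

  starFree-blocked : ∀ M → StarFree (Blocked M)
  starFree-blocked M =
    starFree-∃ λ t → starFree-∃ λ p → starFree-× (postset? p t)
      (concat (complement (starFree-markedAfter M p))
              (concat (letter t) starFree-U))

  -- The start is arbitrary because the inductions below absorb the first letter of the word into
  -- the marking.
  SafeFrom : Pred Marking 0ℓ
  SafeFrom M = ∀ {ts M′} → M [ ts ⟩ M′ → ∀ p → M′ p ≤ 1

  fire : Marking → T → Marking
  fire M t p = (M p ∸ 𝟙 (postset? p t)) + 𝟙 (preset? p t)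

  module _ {M t M′} (safe : SafeFrom M) (fires : Fires M t M′) where

    safeFrom-fires : SafeFrom M′
    safeFrom-fires r = safe (step fires r)

    marked-fires⁺ : ∀ p → preset p t ⊎ (M p > 0 × ¬ Drains p t) → M′ p > 0
    marked-fires⁺ p = subst (_> 0) (sym (proj₂ fires p)) ∘ fire⁺
      where
      fire⁺ : preset p t ⊎ (M p > 0 × ¬ Drains p t) → fire M t p > 0
      fire⁺ h with preset? p t | postset? p t | h
      ... | yes _  | _       | _                  = m≤n+m 1 _
      ... | no ¬in | _       | inj₁ in′           = contradiction in′ ¬in
      ... | no ¬in | yes out | inj₂ (_ , ¬drains) = contradiction (out , ¬in) ¬drains
      ... | no _   | no _    | inj₂ (marked , _)  = m≤n⇒m≤n+o 0 marked

    -- Safety enters here: a place holds at most one token, so a transition that drains it leaves it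
    -- empty.
    marked-fires⁻ : ∀ p → M′ p > 0 → preset p t ⊎ (M p > 0 × ¬ Drains p t)
    -- The empty firing sequence yields the bound on `M` itself.
    marked-fires⁻ p = fire⁻ (safe (stop λ _ → refl) p) ∘ subst (_> 0) (proj₂ fires p)
      where
      fire⁻ : M p ≤ 1 → fire M t p > 0 → preset p t ⊎ (M p > 0 × ¬ Drains p t)
      fire⁻ b h with preset? p t | postset? p t | M p
      ... | yes in′ | _       | _     = inj₁ in′
      ... | no _    | no ¬out | suc _ = inj₂ (s≤s z≤n , ¬out ∘ proj₁)
      fire⁻ (s≤s z≤n) () | no _ | yes _ | suc _
      fire⁻ _         () | no _ | yes _ | zero
      fire⁻ _         () | no _ | no _  | zero

    -- Whether `t` produces the token or spares it, the contribution of the first letter turns into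
    -- a token of `M′`; later producers carry over unchanged.
    markedAfter-fires⁺ : ∀ p {w} → MarkedAfter M p (t ∷ w) → MarkedAfter M′ p w
    markedAfter-fires⁺ p (inj₁ (marked , ¬drains ∷ all)) =
      inj₁ (marked-fires⁺ p (inj₂ (marked , ¬drains)) , all)
    markedAfter-fires⁺ p (inj₂ (inj₁ (in′ , all))) =
      inj₁ (marked-fires⁺ p (inj₁ in′) , all)
    markedAfter-fires⁺ p (inj₂ (inj₂ later)) = inj₂ later

    markedAfter-fires⁻ : ∀ p {w} → MarkedAfter M′ p w → MarkedAfter M p (t ∷ w)
    markedAfter-fires⁻ p (inj₂ later) = inj₂ (inj₂ later)
    markedAfter-fires⁻ p (inj₁ (marked , all)) with marked-fires⁻ p marked
    ... | inj₁ in′                 = inj₂ (inj₁ (in′ , all))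
    ... | inj₂ (marked₀ , ¬drains) = inj₁ (marked₀ , ¬drains ∷ all)

    blocked-fires⁺ : ∀ {w} → Blocked M (t ∷ w) → Blocked M′ w
    -- With an empty prefix the blocked transition would be `t` itself, which is enabled at `M`.
    blocked-fires⁺ (_ , p , out , [] , _ , refl , unmarked , _ , _ , refl , refl , _) =
      contradiction (inj₁ (proj₁ fires p out , [])) unmarked
    blocked-fires⁺ (s , p , out , _ ∷ u , v , refl , unmarked , rest) =
      s , p , out , u , v , refl , unmarked ∘ markedAfter-fires⁻ p , rest

    blocked-fires⁻ : ∀ {w} → Blocked M′ w → Blocked M (t ∷ w)
    blocked-fires⁻ (s , p , out , u , v , refl , unmarked , rest) =
      s , p , out , t ∷ u , v , refl , unmarked ∘ markedAfter-fires⁺ p , rest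

  markedAfter-[]⁻ : ∀ M p → MarkedAfter M p [] → M p > 0
  markedAfter-[]⁻ M p (inj₁ (marked , _)) = marked

  unblocked⇒enabled : ∀ {M t w} → ¬ Blocked M (t ∷ w) → Enabled M t
  unblocked⇒enabled {M} {t} {w} ¬blocked p out =
    -- If `p` were unmarked, the empty prefix would already block `t`.
    decidable-stable (M p >? 0) λ unmarked → ¬blocked
      (t , p , out , [] , t ∷ w , refl , unmarked ∘ markedAfter-[]⁻ M p
      , [ t ] , w , refl , refl , _)

  firingSequence⇒¬blocked : ∀ {M w M′} → SafeFrom M → M [ w ⟩ M′ → ¬ Blocked M w
  firingSequence⇒¬blocked _ (stop _) (_ , _ , _ , [] , _ , refl , _ , _ , _ , () , refl , _)
  firingSequence⇒¬blocked safe (step fires r) =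
    firingSequence⇒¬blocked (safeFrom-fires safe fires) r ∘ blocked-fires⁺ safe fires

  ¬blocked⇒firingSequence : ∀ {M} → SafeFrom M → ∀ w → ¬ Blocked M w → ∃ (M [ w ⟩_)
  ¬blocked⇒firingSequence     _    []      _        = _ , stop λ _ → refl
  ¬blocked⇒firingSequence {M} safe (t ∷ w) ¬blocked =
    let fires = unblocked⇒enabled ¬blocked , λ _ → refl
        M′ , r = ¬blocked⇒firingSequence (safeFrom-fires safe fires) w
                   (¬blocked ∘ blocked-fires⁻ safe fires)
    in M′ , step fires r

  markedAfter⁺ : ∀ {M w M′} → SafeFrom M → M [ w ⟩ M′ →
    ∀ p → MarkedAfter M p w → M′ p > 0
  markedAfter⁺ {M} _ (stop M≗M′)   p = subst (_> 0) (M≗M′ p) ∘ markedAfter-[]⁻ M p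
  markedAfter⁺ safe (step fires r) p =
    markedAfter⁺ (safeFrom-fires safe fires) r p ∘ markedAfter-fires⁺ safe fires p

  markedAfter⁻ : ∀ {M w M′} → SafeFrom M → M [ w ⟩ M′ →
    ∀ p → M′ p > 0 → MarkedAfter M p w
  markedAfter⁻ _    (stop M≗M′)    p marked =
    inj₁ (subst (_> 0) (sym (M≗M′ p)) marked , [])
  markedAfter⁻ safe (step fires r) p =
    markedAfter-fires⁻ safe fires p ∘ markedAfter⁻ (safeFrom-fires safe fires) r p

theorem2 : (W : WorkflowNet) → WorkflowNet.Safe W → WorkflowNet.Sound W →
    StarFree (WorkflowNet.Run W)
theorem2 W safe _ =
  -- Intersection by De Morgan: unblocked words after which `o` is marked. Decidability of
  -- `MarkedAfter` removes the double negation in `to`.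
  resp (to , from)
       (complement (union (starFree-blocked net M₀)
                          (complement (starFree-markedAfter net M₀ o))))
  where
  open WorkflowNet W

  safe₀ : SafeFrom net M₀
  safe₀ r = safe _ (_ , r)

  to : ∀ {w} → ¬ (Blocked net M₀ w ⊎ ¬ MarkedAfter net M₀ o w) → Run w
  to {w} h =
    let M , r = ¬blocked⇒firingSequence net safe₀ w (h ∘ inj₁)
    in M , r , markedAfter⁺ net safe₀ r o
                 (decidable-stable (markedAfter? net M₀ o w) (h ∘ inj₂))

  from : ∀ {w} → Run w → ¬ (Blocked net M₀ w ⊎ ¬ MarkedAfter net M₀ o w)
  from (_ , r , _)     (inj₁ blocked)  = firingSequence⇒¬blocked net safe₀ r blocked
  from (_ , r , final) (inj₂ unmarked) = unmarked (markedAfter⁻ net safe₀ r o final)
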